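{- Let $X$ be a 1-walk regular graph. Then for any two edges $e$ and $f$ of $X$, the graphs $X\backslash e$ and $X\backslash f$ are cospectral with respect to the adjacency matrix.
   Context: A graph is 1-walk regular if for every positive integer $k$ the number of closed walks of length $k$ at a vertex is the same for all vertices, and the number of walks of length $k$ from $u$ to $v$ is the same for all pairs of adjacent vertices $u,v$. $X\backslash e$ is obtained from $X$ by deleting the edge $e$. Adjacency cospectral means the adjacency matrices have the same characteristic polynomial. -}

module Defs where

open import Data.Bool using (Bool; true; false; _∧_; _∨_; not; if_then_else_)
open import Data.Nat as ℕ using (ℕ; zero; suc)
open import Data.Integer as ℤ using (ℤ; +_; -_)
open import Data.Fin using (Fin; zero; suc; punchIn)
open import Data.Fin.Properties using (_≟_)
open import Data.List using (List; []; _∷_)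
open import Relation.Nullary.Decidable using (⌊_⌋)
open import Relation.Binary.PropositionalEquality using (_≡_)

AdjRel : ℕ → Set
AdjRel n = Fin n → Fin n → Bool

record IsSimpleGraph {n : ℕ} (A : AdjRel n) : Set where
  field
    symmetric   : ∀ u v → A u v ≡ A v u
    irreflexive : ∀ u → A u u ≡ false

toℕ : Bool → ℕ
toℕ true  = 1
toℕ false = 0

sumFin : ∀ {n} → (Fin n → ℕ) → ℕ
sumFin {zero}  f = 0
sumFin {suc n} f = f zero ℕ.+ sumFin (λ i → f (suc i))

walks : ∀ {n} → AdjRel n → ℕ → Fin n → Fin n → ℕ
walks A zero    u v = toℕ ⌊ u ≟ v ⌋
walks A (suc k) u v = sumFin (λ w → toℕ (A u w) ℕ.* walks A k w v)

record OneWalkRegular {n : ℕ} (A : AdjRel n) : Set where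
  field
    closed   : ∀ k → 1 ℕ.≤ k → ∀ u v → walks A k u u ≡ walks A k v v
    adjacent : ∀ k → 1 ℕ.≤ k → ∀ u v u' v' → A u v ≡ true → A u' v' ≡ true →
               walks A k u v ≡ walks A k u' v'

deleteEdge : ∀ {n} → AdjRel n → Fin n → Fin n → AdjRel n
deleteEdge A a b x y =
  A x y ∧ not ((⌊ x ≟ a ⌋ ∧ ⌊ y ≟ b ⌋) ∨ (⌊ x ≟ b ⌋ ∧ ⌊ y ≟ a ⌋))

-- Polynomials over ℤ as coefficient lists (constant term first).

Poly : Set
Poly = List ℤ

coeff : Poly → ℕ → ℤ
coeff []       _       = + 0
coeff (c ∷ p)  zero    = c
coeff (c ∷ p)  (suc i) = coeff p i

_≈P_ : Poly → Poly → Set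
p ≈P q = ∀ i → coeff p i ≡ coeff q i

infix 4 _≈P_

_+P_ : Poly → Poly → Poly
[]      +P q       = q
(c ∷ p) +P []      = c ∷ p
(c ∷ p) +P (d ∷ q) = (c ℤ.+ d) ∷ (p +P q)

scaleP : ℤ → Poly → Poly
scaleP c []      = []
scaleP c (d ∷ p) = (c ℤ.* d) ∷ scaleP c p

_*P_ : Poly → Poly → Poly
[]      *P q = []
(c ∷ p) *P q = scaleP c q +P (+ 0 ∷ (p *P q))

negP : Poly → Poly
negP = scaleP (- (+ 1))

sumP : ∀ {n} → (Fin n → Poly) → Poly
sumP {zero}  f = []
sumP {suc n} f = f zero +P sumP (λ i → f (suc i))

signP : ∀ {n} → Fin n → Poly → Poly
signP zero    p = p
signP (suc j) p = negP (signP j p)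

det : ∀ n → (Fin n → Fin n → Poly) → Poly
det zero    M = + 1 ∷ []
det (suc n) M =
  sumP (λ j → signP j (M zero j *P det n (λ r c → M (suc r) (punchIn j c))))

charPoly : ∀ {n} → AdjRel n → Poly
charPoly {n} A = det n entry
  where
  entry : Fin n → Fin n → Poly
  entry i j = if ⌊ i ≟ j ⌋
                then (- (+ toℕ (A i j))) ∷ + 1 ∷ []
                else (- (+ toℕ (A i j))) ∷ []

Cospectral : ∀ {n} → AdjRel n → AdjRel n → Set
Cospectral A B = charPoly A ≈P charPoly B

{-# OPTIONS --safe #-}

-- Work with M = I - tA over the power series ring ℤ[[t]]; the characteristic
-- polynomial is the reversal of det M. Since M⁻¹ = W := ∑ₖ tᵏ Aᵏ and A is
-- symmetric, ∑ⱼ Wⱼᵥ Mⱼ is the unit row eᵥ. Deleting the edge ab adds t e_b to row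
-- a and t e_a to row b of M, so both new rows are combinations of rows of M, and
-- as the determinant is multilinear and alternating it is multiplied by
-- (1 + t W_ab)(1 + t W_ba) - t² W_aa W_bb. The entries of W count closed walks and
-- walks between adjacent vertices, so this factor is the same for every edge.

module Submission where

open import Defs
open import Algebra.Bundles using (CommutativeRing)
import Algebra.Construct.Pointwise as Pointwise
open import Data.Bool using (true; false; not; _∧_; if_then_else_)
open import Data.Bool.Properties using (∧-identityʳ; ∨-identityʳ)
open import Data.Fin using (Fin; zero; suc; punchIn)
open import Data.Fin.Patterns using (0F; 1F)
open import Data.Fin.Properties using (_≟_; suc-injective; punchInᵢ≢i)
open import Data.Integer as ℤ using (ℤ; +_; 0ℤ; 1ℤ)
import Data.Integer.Properties as ℤ
open import Data.Integer.Tactic.RingSolver using (solve-∀)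
open import Data.List using ([]; _∷_)
open import Data.Nat as ℕ using (ℕ; zero; suc; z≤n; s≤s; s<s)
import Data.Nat.Properties as ℕ
open import Data.Product using (_,_)
open import Data.Vec.Functional using (updateAt)
open import Data.Vec.Functional.Properties using (updateAt-updates; updateAt-minimal)
open import Function using (_∘_; const)
open import Level using (0ℓ)
open import Relation.Binary.PropositionalEquality as ≡ using (_≡_; _≢_; _≗_; ≢-sym; module ≡-Reasoning)
open import Relation.Nullary using (yes; no; contradiction)
open import Relation.Nullary.Decidable using (⌊_⌋; isYes≗does; dec-true; dec-false)

-- Determinants over a commutative ring: multilinearity and alternation.

module Determinant {c ℓ} (R : CommutativeRing c ℓ) where
  open CommutativeRing R hiding (zero)
  open import Algebra.Properties.Ring ring using (-1*x≈-x)
  open import Algebra.Properties.Group +-group using (inverseʳ-unique)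
  open import Algebra.Properties.Semiring.Sum semiring
  open import Relation.Binary.Reasoning.Setoid setoid
  open import Algebra.Solver.Ring.NaturalCoefficients.Default commutativeSemiring
    using (solve; con; _:=_; _:+_; _:*_)

  Matrix : ℕ → Set c
  Matrix n = Fin n → Fin n → Carrier

  -- The sign is a ring element built from `- 1#`, so that the solver for commutative semirings,
  -- which knows no negation, can carry `- 1#` as an atom.
  sgn : ∀ {n} → Fin n → Carrier
  sgn zero    = 1#
  sgn (suc j) = - 1# * sgn j

  minor : ∀ {n} → Fin (suc n) → Matrix (suc n) → Matrix n
  minor j M r c = M (suc r) (punchIn j c)

  determinant : ∀ n → Matrix n → Carrier
  determinant zero    M = 1#
  determinant (suc n) M = ∑[ j < suc n ] (sgn j * (M zero j * determinant n (minor j M)))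

  sum-zero : ∀ {n} {f : Fin n → Carrier} → (∀ i → f i ≈ 0#) → sum f ≈ 0#
  sum-zero {n} f≈0 = trans (sum-cong-≋ f≈0) (sum-replicate-zero n)

  sum-only : ∀ {n} {f : Fin n → Carrier} i → (∀ j → j ≢ i → f j ≈ 0#) → sum f ≈ f i
  sum-only {suc n} {f} i f≈0 = begin
    sum f                              ≈⟨ sum-remove {i = i} f ⟩
    f i + ∑[ j < n ] f (punchIn i j)   ≈⟨ +-congˡ (sum-zero λ j → f≈0 _ (punchInᵢ≢i i j)) ⟩
    f i + 0#                           ≈⟨ +-identityʳ _ ⟩
    f i                                ∎

  sum-only₂ : ∀ {n} {f : Fin n → Carrier} i j → i ≢ j →
              (∀ k → k ≢ i → k ≢ j → f k ≈ 0#) → sum f ≈ f i + f j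
  sum-only₂ {f = f} zero    zero    i≢j f≈0 = contradiction ≡.refl i≢j
  sum-only₂ {f = f} zero    (suc j) i≢j f≈0 =
    +-congˡ (sum-only j λ k k≢j → f≈0 (suc k) (λ ()) (k≢j ∘ suc-injective))
  sum-only₂ {f = f} (suc i) zero    i≢j f≈0 = trans
    (+-congˡ (sum-only i λ k k≢i → f≈0 (suc k) (k≢i ∘ suc-injective) (λ ())))
    (+-comm _ _)
  sum-only₂ {f = f} (suc i) (suc j) i≢j f≈0 = trans
    (+-cong (f≈0 zero (λ ()) (λ ()))
      (sum-only₂ i j (i≢j ∘ ≡.cong suc) λ k k≢i k≢j →
        f≈0 (suc k) (k≢i ∘ suc-injective) (k≢j ∘ suc-injective)))
    (+-identityˡ _)

  determinant-cong : ∀ {n} {M N : Matrix n} → (∀ r c → M r c ≈ N r c) →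
                     determinant n M ≈ determinant n N
  determinant-cong {zero}  M≈N = refl
  determinant-cong {suc n} M≈N = sum-cong-≋ λ j →
    *-congˡ {sgn j} (*-cong (M≈N zero j) (determinant-cong λ r c → M≈N (suc r) (punchIn j c)))

  -- Interchanging the two sums carries a linear combination present in every term of a Laplace
  -- expansion out of the whole expansion.
  sum-combination : ∀ {m n} (α : Fin m → Carrier) {f : Fin n → Carrier} (g : Fin m → Fin n → Carrier) →
    (∀ c → f c ≈ ∑[ j < m ] (α j * g j c)) →
    sum f ≈ ∑[ j < m ] (α j * sum (g j))
  sum-combination {m} {n} α {f} g f≈ = begin
    sum f                                 ≈⟨ sum-cong-≋ f≈ ⟩
    ∑[ c < n ] ∑[ j < m ] (α j * g j c)   ≈⟨ ∑-comm (λ c j → α j * g j c) ⟩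
    ∑[ j < m ] ∑[ c < n ] (α j * g j c)   ≈⟨ sum-cong-≋ (λ j → *-distribˡ-sum (α j) (g j)) ⟨
    ∑[ j < m ] (α j * sum (g j))          ∎

  -- Induction along the first-row expansion: for the first row the combination sits in the entries
  -- and the minors agree; for a later row it sits in the minors. Treating arbitrary combinations
  -- lets a row be expanded in all rows of a matrix at once.
  determinant-multilinear : ∀ {m n} (i : Fin n) {M : Matrix n} (α : Fin m → Carrier) (N : Fin m → Matrix n) →
    (∀ c → M i c ≈ ∑[ j < m ] (α j * N j i c)) →
    (∀ j k → k ≢ i → ∀ c → M k c ≈ N j k c) →
    determinant n M ≈ ∑[ j < m ] (α j * determinant n (N j))
  determinant-multilinear {m} {suc n} zero {M} α N row others =
    sum-combination α (λ j c → sgn c * (N j zero c * determinant n (minor c (N j)))) λ c → begin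
    sgn c * (M zero c * determinant n (minor c M))
      ≈⟨ *-congˡ (*-congʳ (row c)) ⟩
    sgn c * ((∑[ j < m ] (α j * N j zero c)) * determinant n (minor c M))
      ≈⟨ *-congˡ (*-distribʳ-sum (determinant n (minor c M)) (λ j → α j * N j zero c)) ⟩
    sgn c * (∑[ j < m ] (α j * N j zero c * determinant n (minor c M)))
      ≈⟨ *-distribˡ-sum (sgn c) (λ j → α j * N j zero c * determinant n (minor c M)) ⟩
    ∑[ j < m ] (sgn c * (α j * N j zero c * determinant n (minor c M)))
      ≈⟨ sum-cong-≋ (λ j → *-congˡ (*-congˡ {α j * N j zero c}
           (determinant-cong λ r c′ → others j (suc r) (λ ()) (punchIn c c′)))) ⟩
    ∑[ j < m ] (sgn c * (α j * N j zero c * determinant n (minor c (N j))))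
      ≈⟨ sum-cong-≋ (λ j → solve 4 (λ s a x d → s :* (a :* x :* d) := a :* (s :* (x :* d))) refl
           (sgn c) (α j) (N j zero c) (determinant n (minor c (N j)))) ⟩
    ∑[ j < m ] (α j * (sgn c * (N j zero c * determinant n (minor c (N j))))) ∎
  determinant-multilinear {m} {suc n} (suc i) {M} α N row others =
    sum-combination α (λ j c → sgn c * (N j zero c * determinant n (minor c (N j)))) λ c → begin
    sgn c * (M zero c * determinant n (minor c M))
      ≈⟨ *-congˡ (*-congˡ (determinant-multilinear i α (minor c ∘ N) (row ∘ punchIn c)
           λ j k k≢i → others j (suc k) (k≢i ∘ suc-injective) ∘ punchIn c)) ⟩
    sgn c * (M zero c * (∑[ j < m ] (α j * determinant n (minor c (N j)))))
      ≈⟨ *-congˡ (*-distribˡ-sum (M zero c) (λ j → α j * determinant n (minor c (N j)))) ⟩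
    sgn c * (∑[ j < m ] (M zero c * (α j * determinant n (minor c (N j)))))
      ≈⟨ *-distribˡ-sum (sgn c) (λ j → M zero c * (α j * determinant n (minor c (N j)))) ⟩
    ∑[ j < m ] (sgn c * (M zero c * (α j * determinant n (minor c (N j)))))
      ≈⟨ sum-cong-≋ (λ j → *-congˡ (*-congʳ (others j zero (λ ()) c))) ⟩
    ∑[ j < m ] (sgn c * (N j zero c * (α j * determinant n (minor c (N j)))))
      ≈⟨ sum-cong-≋ (λ j → solve 4 (λ s a x d → s :* (x :* (a :* d)) := a :* (s :* (x :* d))) refl
           (sgn c) (α j) (N j zero c) (determinant n (minor c (N j)))) ⟩
    ∑[ j < m ] (α j * (sgn c * (N j zero c * determinant n (minor c (N j))))) ∎

  -- Expanding two equal rows u along both: the term taking columns j then k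
  -- cancels against the one taking k then j, since both delete the same columns.
  double-expansion : ∀ n (u : Fin (suc (suc n)) → Carrier) (H : (Fin n → Fin (suc (suc n))) → Carrier) →
    (∀ {φ ψ} → (∀ c → φ c ≡ ψ c) → H φ ≈ H ψ) →
    ∑[ j < suc (suc n) ] (sgn j * (u j *
      (∑[ k < suc n ] (sgn k * (u (punchIn j k) * H (punchIn j ∘ punchIn k)))))) ≈ 0#
  double-expansion n u H H-cong = begin
    -- The pairs of columns containing column `zero` are split off. Those with `j` equal to `zero`
    -- give `sum A`; those with `k` equal to `zero` give its negative, because `suc j` carries one
    -- more sign than `j`.
    1# * (u zero * sum T) +
    ∑[ j < suc n ] (ε * sgn j * (u (suc j) * (1# * (u zero * H (punchIn (suc j) ∘ suc)) + V j)))
      ≈⟨ +-cong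
           (trans (*-identityˡ _) (*-distribˡ-sum (u zero) T))
           (trans
             (sum-cong-≋ {x = λ j → ε * sgn j * (u (suc j) * (1# * (u zero * H (punchIn (suc j) ∘ suc)) + V j))} λ j → trans
               (*-congˡ {ε * sgn j} (*-congˡ {u (suc j)} (+-congʳ (trans (*-identityˡ _) (*-congˡ (H-cong (λ _ → ≡.refl)))))))
               (solve 6 (λ e s x y h v →
                   e :* s :* (x :* (y :* h :+ v)) := e :* (y :* (s :* (x :* h))) :+ e :* s :* (x :* v)) refl
                 ε (sgn j) (u (suc j)) (u zero) (H (suc ∘ punchIn j)) (V j)))
             (∑-distrib-+ (λ j → ε * (u zero * T j)) (λ j → ε * sgn j * (u (suc j) * V j)))) ⟩
    sum A + (∑[ j < suc n ] (ε * A j) + ∑[ j < suc n ] (ε * sgn j * (u (suc j) * V j)))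
      ≈⟨ +-congˡ (+-cong (trans (sym (*-distribˡ-sum ε A)) (-1*x≈-x (sum A))) (rest n u H H-cong)) ⟩
    sum A + (- sum A + 0#)
      ≈⟨ +-congˡ (+-identityʳ _) ⟩
    sum A + - sum A
      ≈⟨ -‿inverseʳ _ ⟩
    0# ∎
    where
    ε : Carrier
    ε = - 1#
    T A : Fin (suc n) → Carrier
    T k = sgn k * (u (suc k) * H (suc ∘ punchIn k))
    A k = u zero * T k
    V : Fin (suc n) → Carrier
    V j = ∑[ k < n ] (ε * sgn k * (u (suc (punchIn j k)) * H (punchIn (suc j) ∘ punchIn (suc k))))

    -- Both chosen columns are nonzero here, so column `zero` is always kept. `lift` puts it back,
    -- which turns the sum into a double expansion with one column fewer, times the factor `ε * ε`.
    rest : ∀ n (u : Fin (suc (suc n)) → Carrier) (H : (Fin n → Fin (suc (suc n))) → Carrier) →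
      (∀ {φ ψ} → (∀ c → φ c ≡ ψ c) → H φ ≈ H ψ) →
      ∑[ j < suc n ] (ε * sgn j * (u (suc j) * ∑[ k < n ]
        (ε * sgn k * (u (suc (punchIn j k)) * H (punchIn (suc j) ∘ punchIn (suc k)))))) ≈ 0#
    rest zero    u H H-cong = sum-zero {1} λ j → trans (*-congˡ {ε * sgn j} (zeroʳ (u (suc j)))) (zeroʳ _)
    rest (suc n) u H H-cong = begin
      ∑[ j < suc (suc n) ] (ε * sgn j * (u (suc j) * ∑[ k < suc n ] (ε * sgn k * B j k)))
        ≈⟨ sum-cong-≋ (λ j → *-congˡ {ε * sgn j} (*-congˡ {u (suc j)} (trans
             (sum-cong-≋ λ k → trans (*-assoc ε (sgn k) (B j k))
               (*-congˡ {ε} (*-congˡ {sgn k} (*-congˡ {u (suc (punchIn j k))} (H-cong (lift-punchIn j k))))))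
             (sym (*-distribˡ-sum ε (λ k → sgn k * C j k)))))) ⟩
      ∑[ j < suc (suc n) ] (ε * sgn j * (u (suc j) * (ε * ∑[ k < suc n ] (sgn k * C j k))))
        ≈⟨ sum-cong-≋ (λ j → solve 4 (λ e s x w → e :* s :* (x :* (e :* w)) := e :* e :* (s :* (x :* w))) refl
             ε (sgn j) (u (suc j)) (∑[ k < suc n ] (sgn k * C j k))) ⟩
      ∑[ j < suc (suc n) ] (ε * ε * (sgn j * (u (suc j) * (∑[ k < suc n ] (sgn k * C j k)))))
        ≈⟨ *-distribˡ-sum (ε * ε) (λ j → sgn j * (u (suc j) * (∑[ k < suc n ] (sgn k * C j k)))) ⟨
      ε * ε * (∑[ j < suc (suc n) ] (sgn j * (u (suc j) * (∑[ k < suc n ] (sgn k * C j k)))))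
        ≈⟨ *-congˡ (double-expansion n (u ∘ suc) (H ∘ lift)
             λ φ≗ψ → H-cong λ { zero → ≡.refl ; (suc c) → ≡.cong suc (φ≗ψ c) }) ⟩
      ε * ε * 0#
        ≈⟨ zeroʳ _ ⟩
      0# ∎
      where
      lift : (Fin n → Fin (suc (suc n))) → Fin (suc n) → Fin (suc (suc (suc n)))
      lift φ zero    = zero
      lift φ (suc c) = suc (φ c)
      lift-punchIn : ∀ j k c → punchIn (suc j) (punchIn (suc k) c) ≡ lift (punchIn j ∘ punchIn k) c
      lift-punchIn j k zero    = ≡.refl
      lift-punchIn j k (suc c) = ≡.refl
      B C : Fin (suc (suc n)) → Fin (suc n) → Carrier
      B j k = u (suc (punchIn j k)) * H (punchIn (suc j) ∘ punchIn (suc k))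
      C j k = u (suc (punchIn j k)) * H (lift (punchIn j ∘ punchIn k))

  -- If p ≡ q then the row s wins.
  replace : ∀ {n} → Matrix n → (p q : Fin n) → (r s : Fin n → Carrier) → Matrix n
  replace M p q r s = updateAt (updateAt M p (const r)) q (const s)

  module _ {n} (M : Matrix n) (p q : Fin n) where
    replace-snd : ∀ {r s} c → replace M p q r s q c ≈ s c
    replace-snd c = reflexive (≡.cong-app (updateAt-updates q _) c)

    replace-other : ∀ {r s k} → k ≢ p → k ≢ q → ∀ c → replace M p q r s k c ≈ M k c
    replace-other {k = k} k≢p k≢q c = reflexive (≡.cong-app
      (≡.trans (updateAt-minimal k q _ k≢q) (updateAt-minimal k p M k≢p)) c)

    replace-fst-irrelevant : ∀ {r r′ s k} → k ≢ p → ∀ c → replace M p q r s k c ≈ replace M p q r′ s k c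
    replace-fst-irrelevant {k = k} k≢p c with k ≟ q
    ... | yes ≡.refl = trans (replace-snd c) (sym (replace-snd c))
    ... | no k≢q     = trans (replace-other k≢p k≢q c) (sym (replace-other k≢p k≢q c))

    replace-snd-irrelevant : ∀ {r s s′ k} → k ≢ q → ∀ c → replace M p q r s k c ≈ replace M p q r s′ k c
    replace-snd-irrelevant {k = k} k≢q c = reflexive (≡.cong-app
      (≡.trans (updateAt-minimal k q _ k≢q) (≡.sym (updateAt-minimal k q _ k≢q))) c)

    replace-multilinear-snd : ∀ {m} r (β : Fin m → Carrier) (V : Fin m → Fin n → Carrier) →
      determinant n (replace M p q r λ c → ∑[ j < m ] (β j * V j c)) ≈
      ∑[ j < m ] (β j * determinant n (replace M p q r (V j)))
    replace-multilinear-snd r β V = determinant-multilinear q β (λ j → replace M p q r (V j))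
      (λ c → trans (replace-snd c) (sum-cong-≋ λ j → *-congˡ {β j} (sym (replace-snd c))))
      (λ j k → replace-snd-irrelevant)

    module _ (p≢q : p ≢ q) where
      replace-fst : ∀ {r s} c → replace M p q r s p c ≈ r c
      replace-fst c = reflexive (≡.cong-app
        (≡.trans (updateAt-minimal p q _ p≢q) (updateAt-updates p M)) c)

      replace-unique : ∀ {N : Matrix n} {r s} → (∀ c → r c ≈ N p c) → (∀ c → s c ≈ N q c) →
        (∀ k → k ≢ p → k ≢ q → ∀ c → M k c ≈ N k c) → ∀ k c → replace M p q r s k c ≈ N k c
      replace-unique r≈ s≈ M≈ k c with k ≟ p | k ≟ q
      ... | yes ≡.refl | _          = trans (replace-fst c) (r≈ c)
      ... | no _       | yes ≡.refl = trans (replace-snd c) (s≈ c)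
      ... | no k≢p     | no k≢q     = trans (replace-other k≢p k≢q c) (M≈ k k≢p k≢q c)

      replace-multilinear-fst : ∀ {m} (α : Fin m → Carrier) (V : Fin m → Fin n → Carrier) s →
        determinant n (replace M p q (λ c → ∑[ j < m ] (α j * V j c)) s) ≈
        ∑[ j < m ] (α j * determinant n (replace M p q (V j) s))
      replace-multilinear-fst α V s = determinant-multilinear p α (λ j → replace M p q (V j) s)
        (λ c → trans (replace-fst c) (sum-cong-≋ λ j → *-congˡ {α j} (sym (replace-fst c))))
        (λ j k → replace-fst-irrelevant)

  -- A property of a single pair of rows, so that antisymmetry in one pair is available while
  -- vanishing for other pairs is still being proved.
  AlternatingIn : ∀ {n} → (p q : Fin n) → Set _
  AlternatingIn {n} p q = ∀ (M : Matrix n) → (∀ c → M p c ≈ M q c) → determinant n M ≈ 0#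

  -- Polarization: the determinant with `r+s` in both rows vanishes, and so do the terms of its
  -- expansion with `r` twice or `s` twice, which leaves the two mixed terms.
  alternating⇒antisymmetric : ∀ {n} {p q : Fin n} → p ≢ q → AlternatingIn p q → ∀ M r s →
    determinant n (replace M p q r s) + determinant n (replace M p q s r) ≈ 0#
  alternating⇒antisymmetric {n} {p} {q} p≢q alt M r s = begin
    D 0F 1F + D 1F 0F
      ≈⟨ solve 2 (λ x y → x :+ y := (con 1 :* (con 1 :* con 0 :+ (con 1 :* x :+ con 0)))
           :+ (con 1 :* (con 1 :* y :+ (con 1 :* con 0 :+ con 0)) :+ con 0)) refl (D 0F 1F) (D 1F 0F) ⟩
    -- The double sum over `Fin 2` of the next line, unfolded, with the vanishing `D 0F 0F` and
    -- `D 1F 1F` replaced by `0#`.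
    1# * (1# * 0# + (1# * D 0F 1F + 0#)) + (1# * (1# * D 1F 0F + (1# * 0# + 0#)) + 0#)
      ≈⟨ +-cong (*-congˡ (+-congʳ (*-congˡ (repeated 0F))))
           (+-congʳ (*-congˡ (+-congˡ (+-congʳ (*-congˡ (repeated 1F)))))) ⟨
    ∑[ j < 2 ] (1# * ∑[ k < 2 ] (1# * D j k))
      ≈⟨ sum-cong-≋ {2} (λ j → *-congˡ {1#} (replace-multilinear-snd M p q (V j) (const 1#) V)) ⟨
    ∑[ j < 2 ] (1# * determinant n (replace M p q (V j) r+s))
      ≈⟨ replace-multilinear-fst M p q p≢q (const 1#) V r+s ⟨
    determinant n (replace M p q r+s r+s)
      ≈⟨ alt _ (λ c → trans (replace-fst M p q p≢q c) (sym (replace-snd M p q c))) ⟩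
    0# ∎
    where
    V : Fin 2 → Fin n → Carrier
    V 0F = r
    V 1F = s
    D : Fin 2 → Fin 2 → Carrier
    D j k = determinant n (replace M p q (V j) (V k))
    r+s : Fin n → Carrier
    r+s c = ∑[ j < 2 ] (1# * V j c)
    repeated : ∀ j → D j j ≈ 0#
    repeated j = alt _ λ c → trans (replace-fst M p q p≢q c) (sym (replace-snd M p q c))

  -- With both equal rows below the first, every minor of the expansion has two equal rows.
  alternating-suc : ∀ {n} {i j : Fin n} → AlternatingIn i j → AlternatingIn (suc i) (suc j)
  alternating-suc alt M eq = sum-zero λ c → trans
    (*-congˡ {sgn c} (trans (*-congˡ {M zero c} (alt (minor c M) (eq ∘ punchIn c))) (zeroʳ _)))
    (zeroʳ _)

  -- Two equal top rows fall to `double-expansion`, with `H` the determinant of the rows below on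
  -- the remaining columns. For a later row, antisymmetry among the rows below the first comes from
  -- alternation one size down.
  alternating-zero : ∀ {n} → (∀ i j → i ≢ j → AlternatingIn {n} i j) →
                     ∀ j → AlternatingIn {suc n} zero (suc j)
  alternating-zero {suc n} alt zero M eq = trans
    (sum-cong-≋ λ j → *-congˡ {sgn j} (*-congˡ {M zero j} (sum-cong-≋ λ k →
      *-congˡ {sgn k} (*-congʳ {determinant n (minor k (minor j M))} (sym (eq (punchIn j k)))))))
    (double-expansion n (M zero) (λ φ → determinant n λ r c → M (suc (suc r)) (φ c))
      λ φ≗ψ → determinant-cong λ r c → reflexive (≡.cong (M (suc (suc r))) (φ≗ψ c)))
  -- Exchange the second row with the one equal to the first.
  alternating-zero {suc n} alt (suc j) M eq = begin
    determinant _ M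
      ≈⟨ +-identityʳ _ ⟨
    determinant _ M + 0#
      ≈⟨ +-cong
           (determinant-cong λ k c → sym (replace-unique M 1F q (λ ()) (λ _ → refl) (λ _ → refl) (λ _ _ _ _ → refl) k c))
           (sym (alternating-zero alt zero (replace M 1F q (M q) (M 1F)) λ c → trans
             (replace-other M 1F q {M q} {M 1F} {zero} (λ ()) (λ ()) c)
             (trans (eq c) (sym (replace-fst M 1F q (λ ()) {M q} {M 1F} c))))) ⟩
    determinant _ (replace M 1F q (M 1F) (M q)) + determinant _ (replace M 1F q (M q) (M 1F))
      ≈⟨ alternating⇒antisymmetric (λ ()) (alternating-suc (alt zero (suc j) (λ ()))) M (M 1F) (M q) ⟩
    0# ∎
    where
    q = suc (suc j)

  determinant-alternating : ∀ {n} (i j : Fin n) → i ≢ j → AlternatingIn i j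
  determinant-alternating zero    zero    i≢j = contradiction ≡.refl i≢j
  determinant-alternating zero    (suc j) i≢j = alternating-zero determinant-alternating j
  determinant-alternating (suc i) zero    i≢j M eq = alternating-zero determinant-alternating i M (sym ∘ eq)
  determinant-alternating (suc i) (suc j) i≢j =
    alternating-suc (determinant-alternating i j (i≢j ∘ ≡.cong suc))

  -- When both rows are expanded in the rows of `M`, only the choices `p, q` and `q, p` avoid a
  -- repeated row. The second is an exchange and contributes the minus sign, so the factor is a 2 by
  -- 2 minor of the coefficients.
  determinant-replace : ∀ {n} (M : Matrix n) {p q} → p ≢ q → (α β : Fin n → Carrier) →
    determinant n (replace M p q (λ c → ∑[ j < n ] (α j * M j c)) (λ c → ∑[ j < n ] (β j * M j c)))
    ≈ (α p * β q + - (α q * β p)) * determinant n M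
  determinant-replace {n} M {p} {q} p≢q α β = begin
    determinant n (replace M p q (λ c → ∑[ j < n ] (α j * M j c)) βM)
      ≈⟨ replace-multilinear-fst M p q p≢q α M βM ⟩
    ∑[ j < n ] (α j * E j)
      -- For `k` other than `p` and `q`, the row `M k` occurs twice: in place `p` and in its own
      -- place.
      ≈⟨ sum-only₂ p q p≢q (λ k k≢p k≢q → vanish (determinant-alternating p k (≢-sym k≢p) _ λ c → trans
           (replace-fst M p q p≢q c) (sym (replace-other M p q k≢p k≢q c)))) ⟩
    α p * E p + α q * E q
      ≈⟨ +-cong (*-congˡ Ep) (*-congˡ Eq) ⟩
    α p * (β q * determinant n M) + α q * (β p * (- 1# * determinant n M))
      ≈⟨ solve 6 (λ a b a′ b′ e d → a :* (b′ :* d) :+ a′ :* (b :* (e :* d)) := (a :* b′ :+ e :* (a′ :* b)) :* d) refl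
           (α p) (β p) (α q) (β q) (- 1#) (determinant n M) ⟩
    (α p * β q + - 1# * (α q * β p)) * determinant n M
      ≈⟨ *-congʳ (+-congˡ (-1*x≈-x _)) ⟩
    (α p * β q + - (α q * β p)) * determinant n M ∎
    where
    βM : Fin n → Carrier
    βM c = ∑[ j < n ] (β j * M j c)
    E : Fin n → Carrier
    E j = determinant n (replace M p q (M j) βM)
    D : Fin n → Fin n → Carrier
    D j k = determinant n (replace M p q (M j) (M k))
    vanish : ∀ {x y} → y ≈ 0# → x * y ≈ 0#
    vanish y≈0 = trans (*-congˡ y≈0) (zeroʳ _)
    Dpq : D p q ≈ determinant n M
    Dpq = determinant-cong (replace-unique M p q p≢q (λ _ → refl) (λ _ → refl) (λ _ _ _ _ → refl))
    Dqp : D q p ≈ - 1# * determinant n M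
    Dqp = begin
      D q p                    ≈⟨ inverseʳ-unique _ _ (alternating⇒antisymmetric p≢q
                                    (determinant-alternating p q p≢q) M (M p) (M q)) ⟩
      - D p q                  ≈⟨ -‿cong Dpq ⟩
      - determinant n M        ≈⟨ -1*x≈-x _ ⟨
      - 1# * determinant n M   ∎
    Ep : E p ≈ β q * determinant n M
    Ep = begin
      E p                       ≈⟨ replace-multilinear-snd M p q (M p) β M ⟩
      ∑[ k < n ] (β k * D p k)  ≈⟨ sum-only q (λ k k≢q → vanish (Dpk k k≢q)) ⟩
      β q * D p q               ≈⟨ *-congˡ Dpq ⟩
      β q * determinant n M     ∎
      where
      Dpk : ∀ k → k ≢ q → D p k ≈ 0#
      -- If `k` is `p`, the repeated row stands in places `p` and `q`; otherwise `M k` stands in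
      -- place `q` and still in its own.
      Dpk k k≢q with k ≟ p
      ... | yes ≡.refl = determinant-alternating p q p≢q _ λ c →
        trans (replace-fst M p q p≢q c) (sym (replace-snd M p q c))
      ... | no k≢p = determinant-alternating k q k≢q _ λ c →
        trans (replace-other M p q k≢p k≢q c) (sym (replace-snd M p q c))
    Eq : E q ≈ β p * (- 1# * determinant n M)
    Eq = begin
      E q                                ≈⟨ replace-multilinear-snd M p q (M q) β M ⟩
      ∑[ k < n ] (β k * D q k)           ≈⟨ sum-only p (λ k k≢p → vanish (Dqk k k≢p)) ⟩
      β p * D q p                        ≈⟨ *-congˡ Dqp ⟩
      β p * (- 1# * determinant n M)     ∎
      where
      Dqk : ∀ k → k ≢ p → D q k ≈ 0#
      Dqk k k≢p with k ≟ q
      ... | yes ≡.refl = determinant-alternating p q p≢q _ λ c →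
        trans (replace-fst M p q p≢q c) (sym (replace-snd M p q c))
      ... | no k≢q = determinant-alternating k q k≢q _ λ c →
        trans (replace-other M p q k≢p k≢q c) (sym (replace-snd M p q c))

open ≡ using (refl; sym; trans; cong; cong₂)
open import Data.Integer using (-_)

-- The ring of formal power series over ℤ.

Series : Set
Series = ℕ → ℤ

infixl 6 _⊞_
infixl 7 _⊛_

_⊞_ : Series → Series → Series
(f ⊞ g) n = f n ℤ.+ g n

-- The Cauchy product, computed by splitting `f` as `f 0` plus t times `f ∘ suc`. The ring laws are
-- accordingly proved by induction on the coefficient index, passing to the tail of the left factor.
_⊛_ : Series → Series → Series
(f ⊛ g) zero    = f 0 ℤ.* g 0
(f ⊛ g) (suc n) = f 0 ℤ.* g (suc n) ℤ.+ ((f ∘ suc) ⊛ g) n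

constant : ℤ → Series
constant z zero    = z
constant z (suc n) = 0ℤ

shift : Series → Series
shift f zero    = 0ℤ
shift f (suc n) = f n

⊛-cong : ∀ {f f′ g g′} → f ≗ f′ → g ≗ g′ → f ⊛ g ≗ f′ ⊛ g′
⊛-cong f≗ g≗ zero    = cong₂ ℤ._*_ (f≗ 0) (g≗ 0)
⊛-cong f≗ g≗ (suc n) =
  cong₂ ℤ._+_ (cong₂ ℤ._*_ (f≗ 0) (g≗ (suc n))) (⊛-cong (f≗ ∘ suc) g≗ n)

⊛-zeroˡ : ∀ g → const 0ℤ ⊛ g ≗ const 0ℤ
⊛-zeroˡ g zero    = refl
⊛-zeroˡ g (suc n) = trans (ℤ.+-identityˡ _) (⊛-zeroˡ g n)

⊛-constantˡ : ∀ z g n → (constant z ⊛ g) n ≡ z ℤ.* g n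
⊛-constantˡ z g zero    = refl
⊛-constantˡ z g (suc n) = trans (cong (ℤ._+_ (z ℤ.* g (suc n))) (⊛-zeroˡ g n)) (ℤ.+-identityʳ _)

⊛-distribʳ-⊞ : ∀ h f g → (f ⊞ g) ⊛ h ≗ f ⊛ h ⊞ g ⊛ h
⊛-distribʳ-⊞ h f g zero    = ℤ.*-distribʳ-+ (h 0) (f 0) (g 0)
⊛-distribʳ-⊞ h f g (suc n) = trans
  (cong (ℤ._+_ ((f 0 ℤ.+ g 0) ℤ.* h (suc n))) (⊛-distribʳ-⊞ h (f ∘ suc) (g ∘ suc) n))
  (rearrange (f 0) (g 0) (h (suc n)) _ _)
  where
  rearrange : ∀ a b c x y → (a ℤ.+ b) ℤ.* c ℤ.+ (x ℤ.+ y) ≡ a ℤ.* c ℤ.+ x ℤ.+ (b ℤ.* c ℤ.+ y)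
  rearrange = solve-∀

⊛-scaleˡ : ∀ z f g n → ((λ m → z ℤ.* f m) ⊛ g) n ≡ z ℤ.* (f ⊛ g) n
⊛-scaleˡ z f g zero    = ℤ.*-assoc z (f 0) (g 0)
⊛-scaleˡ z f g (suc n) = trans
  (cong (ℤ._+_ (z ℤ.* f 0 ℤ.* g (suc n))) (⊛-scaleˡ z (f ∘ suc) g n))
  (rearrange z (f 0) (g (suc n)) _)
  where
  rearrange : ∀ z a b x → z ℤ.* a ℤ.* b ℤ.+ z ℤ.* x ≡ z ℤ.* (a ℤ.* b ℤ.+ x)
  rearrange = solve-∀

-- The tail of `f ⊛ g` is by definition `f 0` times the tail of `g`, plus `(f ∘ suc) ⊛ g`. The first
-- summand is handled by scaling, the second by induction.
⊛-assoc : ∀ f g h → (f ⊛ g) ⊛ h ≗ f ⊛ (g ⊛ h)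
⊛-assoc f g h zero    = ℤ.*-assoc (f 0) (g 0) (h 0)
⊛-assoc f g h (suc n) = begin
  f 0 ℤ.* g 0 ℤ.* h (suc n) ℤ.+ (((λ m → f 0 ℤ.* g (suc m)) ⊞ ((f ∘ suc) ⊛ g)) ⊛ h) n
    ≡⟨ cong (ℤ._+_ (f 0 ℤ.* g 0 ℤ.* h (suc n))) (trans
         (⊛-distribʳ-⊞ h (λ m → f 0 ℤ.* g (suc m)) ((f ∘ suc) ⊛ g) n)
         (cong₂ ℤ._+_ (⊛-scaleˡ (f 0) (g ∘ suc) h n) (⊛-assoc (f ∘ suc) g h n))) ⟩
  f 0 ℤ.* g 0 ℤ.* h (suc n) ℤ.+ (f 0 ℤ.* ((g ∘ suc) ⊛ h) n ℤ.+ ((f ∘ suc) ⊛ (g ⊛ h)) n)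
    ≡⟨ rearrange (f 0) (g 0) (h (suc n)) _ _ ⟩
  f 0 ℤ.* (g 0 ℤ.* h (suc n) ℤ.+ ((g ∘ suc) ⊛ h) n) ℤ.+ ((f ∘ suc) ⊛ (g ⊛ h)) n ∎
  where
  open ≡-Reasoning
  rearrange : ∀ a b c x y → a ℤ.* b ℤ.* c ℤ.+ (a ℤ.* x ℤ.+ y) ≡ a ℤ.* (b ℤ.* c ℤ.+ x) ℤ.+ y
  rearrange = solve-∀

-- The product is defined by peeling its left factor; peeling the right one instead is what makes
-- commutativity an induction.
⊛-sucʳ : ∀ f g n → (f ⊛ g) (suc n) ≡ g 0 ℤ.* f (suc n) ℤ.+ (f ⊛ (g ∘ suc)) n
⊛-sucʳ f g zero    = rearrange (f 0) (g 1) (f 1) (g 0)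
  where
  rearrange : ∀ a b c d → a ℤ.* b ℤ.+ c ℤ.* d ≡ d ℤ.* c ℤ.+ a ℤ.* b
  rearrange = solve-∀
⊛-sucʳ f g (suc n) = trans
  (cong (ℤ._+_ (f 0 ℤ.* g (suc (suc n)))) (⊛-sucʳ (f ∘ suc) g n))
  (rearrange (f 0 ℤ.* g (suc (suc n))) (g 0 ℤ.* f (suc (suc n))) _)
  where
  rearrange : ∀ a b x → a ℤ.+ (b ℤ.+ x) ≡ b ℤ.+ (a ℤ.+ x)
  rearrange = solve-∀

⊛-comm : ∀ f g → f ⊛ g ≗ g ⊛ f
⊛-comm f g zero    = ℤ.*-comm (f 0) (g 0)
⊛-comm f g (suc n) = trans
  (cong (ℤ._+_ (f 0 ℤ.* g (suc n))) (⊛-comm (f ∘ suc) g n))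
  (sym (⊛-sucʳ g f n))

shift-⊛ : ∀ f g → shift f ⊛ g ≗ shift (f ⊛ g)
shift-⊛ f g zero    = refl
shift-⊛ f g (suc n) = ℤ.+-identityˡ _

seriesRing : CommutativeRing 0ℓ 0ℓ
seriesRing = record
  { Carrier = Series
  ; _≈_ = _≗_
  ; _+_ = _⊞_
  ; _*_ = _⊛_
  ; -_ = λ f n → - f n
  ; 0# = const 0ℤ
  ; 1# = constant 1ℤ
  ; isCommutativeRing = record
    { isRing = record
      { +-isAbelianGroup = Pointwise.isAbelianGroup ℕ ℤ.+-0-isAbelianGroup
      ; *-cong = ⊛-cong
      ; *-assoc = ⊛-assoc
      ; *-identity = identityˡ , λ f n → trans (⊛-comm f (constant 1ℤ) n) (identityˡ f n)
      ; distrib = (λ f g h n → trans (⊛-comm f (g ⊞ h) n) (trans (⊛-distribʳ-⊞ f g h n)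
                    (cong₂ ℤ._+_ (⊛-comm g f n) (⊛-comm h f n))))
                , ⊛-distribʳ-⊞
      }
    ; *-comm = ⊛-comm
    }
  }
  where
  identityˡ : ∀ f → constant 1ℤ ⊛ f ≗ f
  identityˡ f n = trans (⊛-constantˡ 1ℤ f n) (ℤ.*-identityˡ (f n))

module S where
  open CommutativeRing seriesRing public
  open import Algebra.Properties.Ring ring public using (-1*x≈-x)
  open import Algebra.Properties.Semiring.Sum semiring public
  open Determinant seriesRing public

module Z where
  open import Algebra.Properties.Semiring.Sum (CommutativeRing.semiring ℤ.+-*-commutativeRing) public
  open Determinant ℤ.+-*-commutativeRing public using (sum-only; sum-zero)

sum-coefficient : ∀ {n} (F : Fin n → Series) k → S.sum F k ≡ Z.sum (λ j → F j k)
sum-coefficient {zero}  F k = refl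
sum-coefficient {suc n} F k = cong (ℤ._+_ (F zero k)) (sum-coefficient (F ∘ suc) k)

-- The series q + pt, constant term first.
linear : ℤ → ℤ → Series
linear q p zero          = q
linear q p (suc zero)    = p
linear q p (suc (suc n)) = 0ℤ

linear-⊛ : ∀ q p f n → (linear q p ⊛ f) n ≡ q ℤ.* f n ℤ.+ p ℤ.* shift f n
linear-⊛ q p f zero    = sym (trans (cong (ℤ._+_ (q ℤ.* f 0)) (ℤ.*-zeroʳ p)) (ℤ.+-identityʳ _))
linear-⊛ q p f (suc n) = cong (ℤ._+_ (q ℤ.* f (suc n)))
  (trans (⊛-cong {g = f} tail≗ (λ _ → refl) n) (⊛-constantˡ p f n))
  where
  tail≗ : linear q p ∘ suc ≗ constant p
  tail≗ zero    = refl
  tail≗ (suc _) = refl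

-- Characteristic polynomials as reversals of determinants over series.

coeff-+P : ∀ p q i → coeff (p +P q) i ≡ coeff p i ℤ.+ coeff q i
coeff-+P []      q       i       = sym (ℤ.+-identityˡ _)
coeff-+P (c ∷ p) []      i       = sym (ℤ.+-identityʳ _)
coeff-+P (c ∷ p) (d ∷ q) zero    = refl
coeff-+P (c ∷ p) (d ∷ q) (suc i) = coeff-+P p q i

coeff-scaleP : ∀ z p i → coeff (scaleP z p) i ≡ z ℤ.* coeff p i
coeff-scaleP z []      i       = sym (ℤ.*-zeroʳ z)
coeff-scaleP z (c ∷ p) zero    = refl
coeff-scaleP z (c ∷ p) (suc i) = coeff-scaleP z p i

-- The polynomial a + bx, recorded by the shape of its list: matrix entries have one coefficient off
-- the diagonal and two on it, and `_*P_` recurses on that list.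
data Linear : Poly → ℤ → ℤ → Set where
  scalar : ∀ a → Linear (a ∷ []) a 0ℤ
  affine : ∀ a b → Linear (a ∷ b ∷ []) a b

coeff-linear-*P : ∀ {l a b} → Linear l a b → ∀ p i →
                  coeff (l *P p) i ≡ a ℤ.* coeff p i ℤ.+ b ℤ.* coeff (0ℤ ∷ p) i
coeff-linear-*P (scalar a)   p i = begin
  coeff (scaleP a p +P (0ℤ ∷ [])) i
    ≡⟨ coeff-+P (scaleP a p) (0ℤ ∷ []) i ⟩
  coeff (scaleP a p) i ℤ.+ coeff (0ℤ ∷ []) i
    ≡⟨ cong₂ ℤ._+_ (coeff-scaleP a p i) (coeff-0 i) ⟩
  -- The second summand of the claim is `0ℤ ℤ.* coeff (0ℤ ∷ p) i`, which computes to `0ℤ`.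
  a ℤ.* coeff p i ℤ.+ 0ℤ ∎
  where
  open ≡-Reasoning
  coeff-0 : ∀ i → coeff (0ℤ ∷ []) i ≡ 0ℤ
  coeff-0 zero    = refl
  coeff-0 (suc i) = refl
coeff-linear-*P (affine a b) p i = begin
  coeff (scaleP a p +P (0ℤ ∷ ((b ∷ []) *P p))) i
    ≡⟨ coeff-+P (scaleP a p) _ i ⟩
  coeff (scaleP a p) i ℤ.+ coeff (0ℤ ∷ ((b ∷ []) *P p)) i
    ≡⟨ cong₂ ℤ._+_ (coeff-scaleP a p i) (shifted i) ⟩
  a ℤ.* coeff p i ℤ.+ b ℤ.* coeff (0ℤ ∷ p) i ∎
  where
  open ≡-Reasoning
  shifted : ∀ i → coeff (0ℤ ∷ ((b ∷ []) *P p)) i ≡ b ℤ.* coeff (0ℤ ∷ p) i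
  shifted zero    = sym (ℤ.*-zeroʳ b)
  shifted (suc i) = trans (coeff-linear-*P (scalar b) p i) (ℤ.+-identityʳ _)

-- p has degree at most n and f is the polynomial tⁿ p(1/t).
record Reversal (n : ℕ) (p : Poly) (f : Series) : Set where
  field
    reverse   : ∀ i j → i ℕ.+ j ≡ n → coeff p i ≡ f j
    p-degree≤ : ∀ i → n ℕ.< i → coeff p i ≡ 0ℤ
    f-degree≤ : ∀ j → n ℕ.< j → f j ≡ 0ℤ
open Reversal

reversal-cong : ∀ {n p f g} → f ≗ g → Reversal n p f → Reversal n p g
reversal-cong f≗g R .reverse i j eq = trans (reverse R i j eq) (f≗g j)
reversal-cong f≗g R .p-degree≤      = p-degree≤ R
reversal-cong f≗g R .f-degree≤ j lt = trans (sym (f≗g j)) (f-degree≤ R j lt)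

-- Once the degree bound is fixed, a polynomial can be read off its reversal. This brings an
-- equality of determinants over series back to characteristic polynomials.
reversal-injective : ∀ {n p q f} → Reversal n p f → Reversal n q f → p ≈P q
reversal-injective {n} P Q i with i ℕ.≤? n
... | yes i≤n = trans (reverse P i (n ℕ.∸ i) (ℕ.m+[n∸m]≡n i≤n)) (sym (reverse Q i (n ℕ.∸ i) (ℕ.m+[n∸m]≡n i≤n)))
... | no  i≰n = trans (p-degree≤ P i (ℕ.≰⇒> i≰n)) (sym (p-degree≤ Q i (ℕ.≰⇒> i≰n)))

reversal-0 : ∀ {n} → Reversal n [] (const 0ℤ)
reversal-0 .reverse   _ _ _ = refl
reversal-0 .p-degree≤ _ _   = refl
reversal-0 .f-degree≤ _ _   = refl

reversal-+ : ∀ {n p q f g} → Reversal n p f → Reversal n q g → Reversal n (p +P q) (f ⊞ g)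
reversal-+ {p = p} {q} P Q .reverse i j eq = trans (coeff-+P p q i) (cong₂ ℤ._+_ (reverse P i j eq) (reverse Q i j eq))
reversal-+ {p = p} {q} P Q .p-degree≤ i lt = trans (coeff-+P p q i) (cong₂ ℤ._+_ (p-degree≤ P i lt) (p-degree≤ Q i lt))
reversal-+ P Q .f-degree≤ j lt             = cong₂ ℤ._+_ (f-degree≤ P j lt) (f-degree≤ Q j lt)

reversal-sum : ∀ {n m} {p : Fin m → Poly} {f : Fin m → Series} →
               (∀ j → Reversal n (p j) (f j)) → Reversal n (sumP p) (S.sum f)
reversal-sum {m = zero}  R = reversal-0
reversal-sum {m = suc m} R = reversal-+ (R zero) (reversal-sum (R ∘ suc))

reversal-neg : ∀ {n p f} → Reversal n p f → Reversal n (negP p) (S.- f)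
reversal-neg {p = p} R .reverse i j eq = trans (coeff-scaleP _ p i) (trans (ℤ.-1*i≡-i _) (cong -_ (reverse R i j eq)))
reversal-neg {p = p} R .p-degree≤ i lt = trans (coeff-scaleP _ p i) (cong (ℤ.-1ℤ ℤ.*_) (p-degree≤ R i lt))
reversal-neg R .f-degree≤ j lt         = cong -_ (f-degree≤ R j lt)

reversal-sign : ∀ {m n p f} (j : Fin m) → Reversal n p f → Reversal n (signP j p) (S.sgn j ⊛ f)
reversal-sign {f = f} zero    R = reversal-cong (S.sym (S.*-identityˡ f)) R
reversal-sign {f = f} (suc j) R = reversal-cong
  (S.trans (S.sym (S.-1*x≈-x (S.sgn j ⊛ f))) (S.sym (S.*-assoc (S.- S.1#) (S.sgn j) f)))
  (reversal-neg (reversal-sign j R))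

-- In t^(n+1) (a + b/t) p(1/t) one factor t goes to the linear polynomial and makes it b + at, so
-- its two coefficients change places.
reversal-linear : ∀ {n l a b p f} → Linear l a b → Reversal n p f →
                  Reversal (suc n) (l *P p) (linear b a ⊛ f)
reversal-linear {n} {l} {a} {b} {p} {f} L R = record
  { reverse   = λ i j eq → trans (coeff-linear-*P L p i) (trans (rev i j eq) (sym (linear-⊛ b a f j)))
  ; p-degree≤ = λ { (suc i) (s<s lt) → trans (coeff-linear-*P L p (suc i))
                      (vanish a b (p-degree≤ R (suc i) (ℕ.m<n⇒m<1+n lt)) (p-degree≤ R i lt)) }
  ; f-degree≤ = λ { (suc j) (s<s lt) → trans (linear-⊛ b a f (suc j))
                      (vanish b a (f-degree≤ R (suc j) (ℕ.m<n⇒m<1+n lt)) (f-degree≤ R j lt)) }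
  }
  where
  vanish : ∀ x y {u v} → u ≡ 0ℤ → v ≡ 0ℤ → x ℤ.* u ℤ.+ y ℤ.* v ≡ 0ℤ
  vanish x y refl refl = cong₂ ℤ._+_ (ℤ.*-zeroʳ x) (ℤ.*-zeroʳ y)

  rev : ∀ i j → i ℕ.+ j ≡ suc n →
        a ℤ.* coeff p i ℤ.+ b ℤ.* coeff (0ℤ ∷ p) i ≡ b ℤ.* f j ℤ.+ a ℤ.* shift f j
  rev i j eq = trans (ℤ.+-comm (a ℤ.* coeff p i) _)
    (cong₂ ℤ._+_ (cong (b ℤ.*_) (lower i j eq)) (cong (a ℤ.*_) (upper i j eq)))
    where
    lower : ∀ i j → i ℕ.+ j ≡ suc n → coeff (0ℤ ∷ p) i ≡ f j
    -- The constant term of xp meets coefficient `suc n` of `f`, just beyond the degree bound.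
    lower zero    j refl = sym (f-degree≤ R j ℕ.≤-refl)
    lower (suc i) j eq   = reverse R i j (ℕ.suc-injective eq)
    upper : ∀ i j → i ℕ.+ j ≡ suc n → coeff p i ≡ shift f j
    -- Here coefficient `suc n` of `p` meets the constant term of tf.
    upper i zero    eq = p-degree≤ R i (ℕ.≤-reflexive (sym (trans (sym (ℕ.+-identityʳ i)) eq)))
    upper i (suc j) eq = reverse R i j (ℕ.suc-injective (trans (sym (ℕ.+-suc i j)) eq))

-- Both determinants expand along the first row in the same way; each level multiplies by one linear
-- entry and raises the degree bound by one.
reversal-det : ∀ n {L : Fin n → Fin n → Poly} {a b : Fin n → Fin n → ℤ} →
  (∀ i j → Linear (L i j) (a i j) (b i j)) →
  Reversal n (det n L) (S.determinant n λ i j → linear (b i j) (a i j))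
reversal-det zero    lin = record
  { reverse   = λ { zero zero _ → refl }
  ; p-degree≤ = λ { (suc i) _ → refl }
  ; f-degree≤ = λ { (suc j) _ → refl }
  }
reversal-det (suc n) lin = reversal-sum λ j → reversal-sign j
  (reversal-linear (lin zero j) (reversal-det n λ r c → lin (suc r) (punchIn j c)))

-- The pencil of a graph, its determinant and its inverse.

δ : ∀ {n} → Fin n → Fin n → ℤ
δ i j = + toℕ ⌊ i ≟ j ⌋

-- The matrix I - tA.
pencil : ∀ {n} → AdjRel n → S.Matrix n
pencil A i j = linear (δ i j) (- (+ toℕ (A i j)))

-- The entries of xI - A reverse to those of I - tA.
reversal-charPoly : ∀ {n} (A : AdjRel n) → Reversal n (charPoly A) (S.determinant n (pencil A))
reversal-charPoly {n} A = reversal-det n λ i j → entry-linear ⌊ i ≟ j ⌋ (- (+ toℕ (A i j)))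
  where
  -- Stated for an arbitrary Boolean, so that one case split settles both the list in `charPoly` and
  -- the value of `δ`.
  entry-linear : ∀ b z → Linear (if b then z ∷ + 1 ∷ [] else z ∷ []) z (+ toℕ b)
  entry-linear true  z = affine z (+ 1)
  entry-linear false z = scalar z

⌊≟⌋-yes : ∀ {n} {i j : Fin n} → i ≡ j → ⌊ i ≟ j ⌋ ≡ true
⌊≟⌋-yes {i = i} {j} i≡j = trans (isYes≗does (i ≟ j)) (dec-true (i ≟ j) i≡j)

⌊≟⌋-no : ∀ {n} {i j : Fin n} → i ≢ j → ⌊ i ≟ j ⌋ ≡ false
⌊≟⌋-no {i = i} {j} i≢j = trans (isYes≗does (i ≟ j)) (dec-false (i ≟ j) i≢j)

⌊≟⌋-sym : ∀ {n} (i j : Fin n) → ⌊ i ≟ j ⌋ ≡ ⌊ j ≟ i ⌋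
⌊≟⌋-sym i j with i ≟ j
... | yes i≡j = sym (⌊≟⌋-yes (sym i≡j))
... | no  i≢j = sym (⌊≟⌋-no (≢-sym i≢j))

δ-refl : ∀ {n} (i : Fin n) → δ i i ≡ 1ℤ
δ-refl i = cong (+_ ∘ toℕ) (⌊≟⌋-yes {i = i} refl)

δ-≢ : ∀ {n} {i j : Fin n} → i ≢ j → δ i j ≡ 0ℤ
δ-≢ i≢j = cong (+_ ∘ toℕ) (⌊≟⌋-no i≢j)

δ-sum : ∀ {n} (i : Fin n) (f : Fin n → ℤ) → Z.sum (λ j → δ i j ℤ.* f j) ≡ f i
δ-sum i f = trans
  (Z.sum-only {f = λ j → δ i j ℤ.* f j} i λ j j≢i → cong (ℤ._* f j) (δ-≢ (≢-sym j≢i)))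
  (trans (cong (ℤ._* f i) (δ-refl i)) (ℤ.*-identityˡ (f i)))

sumFin-sum : ∀ {n} (f : Fin n → ℕ) → + sumFin f ≡ Z.sum (λ j → + f j)
sumFin-sum {zero}  f = refl
sumFin-sum {suc n} f = trans (ℤ.pos-+ (f zero) _) (cong (ℤ._+_ (+ f zero)) (sumFin-sum (f ∘ suc)))

-- The generating function of walks by length, which is an entry of the inverse of I - tA.
walkSeries : ∀ {n} → AdjRel n → Fin n → Fin n → Series
walkSeries A u v k = + walks A k u v

-- The coefficient of t^(k+1) is an entry of A^(k+1) - A A^k, and `walks` is defined by exactly this
-- recursion.
pencil-inverse : ∀ {n} (A : AdjRel n) u v →
  S.sum (λ w → pencil A u w ⊛ walkSeries A w v) ≗ constant (δ u v)
pencil-inverse A u v zero = trans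
  (sum-coefficient (λ w → pencil A u w ⊛ walkSeries A w v) zero)
  (δ-sum u (λ w → δ w v))
pencil-inverse A u v (suc k) = begin
  S.sum (λ w → pencil A u w ⊛ walkSeries A w v) (suc k)
    ≡⟨ sum-coefficient (λ w → pencil A u w ⊛ walkSeries A w v) (suc k) ⟩
  Z.sum (λ w → (pencil A u w ⊛ walkSeries A w v) (suc k))
    ≡⟨ Z.sum-cong-≗ (λ w → linear-⊛ (δ u w) (- a w) (walkSeries A w v) (suc k)) ⟩
  Z.sum (λ w → δ u w ℤ.* walkSeries A w v (suc k) ℤ.+ - a w ℤ.* walkSeries A w v k)
    ≡⟨ Z.∑-distrib-+ (λ w → δ u w ℤ.* walkSeries A w v (suc k)) (λ w → - a w ℤ.* walkSeries A w v k) ⟩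
  Z.sum (λ w → δ u w ℤ.* walkSeries A w v (suc k)) ℤ.+ Z.sum (λ w → - a w ℤ.* walkSeries A w v k)
    ≡⟨ cong (ℤ._+ Z.sum (λ w → - a w ℤ.* walkSeries A w v k)) (trans
         (δ-sum u (λ w → walkSeries A w v (suc k)))
         (trans (sumFin-sum (λ w → toℕ (A u w) ℕ.* walks A k w v))
           (Z.sum-cong-≗ λ w → ℤ.pos-* (toℕ (A u w)) (walks A k w v)))) ⟩
  Z.sum (λ w → a w ℤ.* walkSeries A w v k) ℤ.+ Z.sum (λ w → - a w ℤ.* walkSeries A w v k)
    ≡⟨ Z.∑-distrib-+ (λ w → a w ℤ.* walkSeries A w v k) (λ w → - a w ℤ.* walkSeries A w v k) ⟨
  Z.sum (λ w → a w ℤ.* walkSeries A w v k ℤ.+ - a w ℤ.* walkSeries A w v k)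
    ≡⟨ Z.sum-zero (λ w → cancel (a w) (walkSeries A w v k)) ⟩
  0ℤ ∎
  where
  open ≡-Reasoning
  a : Fin _ → ℤ
  a w = + toℕ (A u w)
  cancel : ∀ x y → x ℤ.* y ℤ.+ - x ℤ.* y ≡ 0ℤ
  cancel = solve-∀

pencil-sym : ∀ {n} {A : AdjRel n} → IsSimpleGraph A → ∀ i j → pencil A i j ≗ pencil A j i
pencil-sym simple i j n = ≡.cong₂ (λ x y → linear (+ toℕ x) (- (+ toℕ y)) n)
  (⌊≟⌋-sym i j) (IsSimpleGraph.symmetric simple i j)

-- The coefficients expressing row a of the pencil of A ∖ ab in the rows of the pencil of A.
weight : ∀ {n} → AdjRel n → (a b j : Fin n) → Series
weight A a b j = constant (δ j a) ⊞ shift (walkSeries A j b)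

-- The `δ` part of the weights selects row `a`; the walk part yields t times a unit row.
-- `pencil-inverse` sums along a row of the pencil while here rows are combined, so the symmetry of
-- the pencil links the two.
weight-combination : ∀ {n} {A : AdjRel n} → IsSimpleGraph A → ∀ a b c →
  S.sum (λ j → weight A a b j ⊛ pencil A j c) ≗ pencil A a c ⊞ shift (constant (δ c b))
weight-combination {n} {A} simple a b c = begin
  S.sum (λ j → weight A a b j ⊛ pencil A j c)
    ≈⟨ S.sum-cong-≋ (λ j → ⊛-distribʳ-⊞ (pencil A j c) (constant (δ j a)) (shift (walkSeries A j b))) ⟩
  S.sum (λ j → constant (δ j a) ⊛ pencil A j c ⊞ shift (walkSeries A j b) ⊛ pencil A j c)
    ≈⟨ S.∑-distrib-+ (λ j → constant (δ j a) ⊛ pencil A j c) (λ j → shift (walkSeries A j b) ⊛ pencil A j c) ⟩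
  S.sum (λ j → constant (δ j a) ⊛ pencil A j c) ⊞ S.sum (λ j → shift (walkSeries A j b) ⊛ pencil A j c)
    ≈⟨ S.+-cong selected shifted ⟩
  pencil A a c ⊞ shift (constant (δ c b)) ∎
  where
  open import Relation.Binary.Reasoning.Setoid S.setoid
  selected : S.sum (λ j → constant (δ j a) ⊛ pencil A j c) ≗ pencil A a c
  selected k = trans
    (S.sum-only {f = λ j → constant (δ j a) ⊛ pencil A j c} a
      (λ j j≢a m → trans (⊛-constantˡ (δ j a) (pencil A j c) m) (cong (ℤ._* pencil A j c m) (δ-≢ j≢a))) k)
    (trans (⊛-constantˡ (δ a a) (pencil A a c) k)
      (trans (cong (ℤ._* pencil A a c k) (δ-refl a)) (ℤ.*-identityˡ _)))
  sum-shift : ∀ {m} (F : Fin m → Series) → S.sum (λ j → shift (F j)) ≗ shift (S.sum F)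
  sum-shift F zero    = trans (sum-coefficient (shift ∘ F) zero) (Z.sum-zero {f = λ j → shift (F j) zero} (λ _ → refl))
  sum-shift F (suc k) = trans (sum-coefficient (shift ∘ F) (suc k)) (sym (sum-coefficient F k))
  shift-cong : ∀ {f g} → f ≗ g → shift f ≗ shift g
  shift-cong f≗g zero    = refl
  shift-cong f≗g (suc k) = f≗g k
  shifted : S.sum (λ j → shift (walkSeries A j b) ⊛ pencil A j c) ≗ shift (constant (δ c b))
  shifted = begin
    S.sum (λ j → shift (walkSeries A j b) ⊛ pencil A j c)
      ≈⟨ S.sum-cong-≋ (λ j → S.trans (shift-⊛ (walkSeries A j b) (pencil A j c))
           (shift-cong (S.trans (⊛-comm (walkSeries A j b) (pencil A j c))
             (⊛-cong {g = walkSeries A j b} (pencil-sym simple j c) (λ _ → refl))))) ⟩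
    S.sum (λ j → shift (pencil A c j ⊛ walkSeries A j b))
      ≈⟨ sum-shift (λ j → pencil A c j ⊛ walkSeries A j b) ⟩
    shift (S.sum (λ j → pencil A c j ⊛ walkSeries A j b))
      ≈⟨ shift-cong (pencil-inverse A c b) ⟩
    shift (constant (δ c b)) ∎

-- Rows of the pencil after deletion of an edge.

module _ {n} (A : AdjRel n) {a b : Fin n} (a≢b : a ≢ b) where
  deleteEdge-fst : ∀ c → deleteEdge A a b a c ≡ A a c ∧ not ⌊ c ≟ b ⌋
  deleteEdge-fst c rewrite ⌊≟⌋-yes {i = a} refl | ⌊≟⌋-no a≢b = cong (λ x → A a c ∧ not x) (∨-identityʳ _)

  deleteEdge-snd : ∀ c → deleteEdge A a b b c ≡ A b c ∧ not ⌊ c ≟ a ⌋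
  deleteEdge-snd c rewrite ⌊≟⌋-yes {i = b} refl | ⌊≟⌋-no (≢-sym a≢b) = refl

  deleteEdge-other : ∀ {x} → x ≢ a → x ≢ b → ∀ c → deleteEdge A a b x c ≡ A x c
  deleteEdge-other x≢a x≢b c rewrite ⌊≟⌋-no x≢a | ⌊≟⌋-no x≢b = ∧-identityʳ _

-- Only the coefficient of t at column `v` changes, from -1 to 0. A single row of an arbitrary `B`
-- is treated, which covers both ends of the edge.
pencil-removal : ∀ {n} {A B : AdjRel n} {u v} → A u v ≡ true →
  (∀ c → B u c ≡ A u c ∧ not ⌊ c ≟ v ⌋) →
  ∀ c → pencil A u c ⊞ shift (constant (δ c v)) ≗ pencil B u c
pencil-removal         Auv B≡ c zero          = ℤ.+-identityʳ _
pencil-removal {A = A} {u = u} {v} Auv B≡ c (suc zero) rewrite B≡ c with c ≟ v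
... | yes refl rewrite Auv = refl
... | no  _    rewrite ∧-identityʳ (A u c) = ℤ.+-identityʳ _
pencil-removal         Auv B≡ c (suc (suc k)) = refl

adjacent⇒≢ : ∀ {n} {A : AdjRel n} → IsSimpleGraph A → ∀ {a b} → A a b ≡ true → a ≢ b
adjacent⇒≢ simple {a} Aab refl with trans (sym Aab) (IsSimpleGraph.irreflexive simple a)
... | ()

-- The factor of `determinant-replace` for rows `a` and `b`. For distinct ends, the weights in the
-- first product have constant term 1 and those in the second are multiples of t.
deletionFactor : ∀ {n} → AdjRel n → Fin n → Fin n → Series
deletionFactor A a b =
  weight A a b a ⊛ weight A b a b S.+ S.- (weight A a b b ⊛ weight A b a a)

-- Rows `a` and `b` of the new pencil are combinations of rows of the old one and all other rows
-- agree, so `determinant-replace` applies.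
determinant-deleteEdge : ∀ {n} {A : AdjRel n} → IsSimpleGraph A → ∀ {a b} → A a b ≡ true →
  S.determinant n (pencil (deleteEdge A a b)) ≗ deletionFactor A a b ⊛ S.determinant n (pencil A)
determinant-deleteEdge {n} {A} simple {a} {b} Aab = S.trans
  (S.determinant-cong λ r c → S.sym (S.replace-unique (pencil A) a b a≢b
    {N = pencil (deleteEdge A a b)}
    (λ c → S.trans (weight-combination simple a b c)
      (pencil-removal {A = A} {deleteEdge A a b} Aab (deleteEdge-fst A a≢b) c))
    -- At the end `b` the roles are exchanged, which calls for the edge in the direction from `b` to
    -- `a`.
    (λ c → S.trans (weight-combination simple b a c)
      (pencil-removal {A = A} {deleteEdge A a b} (trans (IsSimpleGraph.symmetric simple b a) Aab) (deleteEdge-snd A a≢b) c))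
    (λ k k≢a k≢b c m → cong (λ x → linear (δ k c) (- (+ toℕ x)) m)
      (sym (deleteEdge-other A a≢b k≢a k≢b c)))
    r c))
  (S.determinant-replace (pencil A) a≢b (weight A a b) (weight A b a))
  where
  a≢b : a ≢ b
  a≢b = adjacent⇒≢ simple Aab

-- Independence of the edge under 1-walk regularity.

module _ {n} {A : AdjRel n} (simple : IsSimpleGraph A) (regular : OneWalkRegular A) where
  open OneWalkRegular regular

  walkSeries-closed : ∀ u v → walkSeries A u u ≗ walkSeries A v v
  -- Regularity speaks of positive lengths; at length zero each vertex has just the trivial walk.
  walkSeries-closed u v zero    = trans (δ-refl u) (sym (δ-refl v))
  walkSeries-closed u v (suc k) = cong +_ (closed (suc k) (s≤s z≤n) u v)

  walkSeries-adjacent : ∀ {u v u′ v′} → A u v ≡ true → A u′ v′ ≡ true →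
                        walkSeries A u v ≗ walkSeries A u′ v′
  -- No walk of length zero joins the ends of an edge, since there are no loops.
  walkSeries-adjacent uv u′v′ zero    =
    trans (δ-≢ (adjacent⇒≢ simple uv)) (sym (δ-≢ (adjacent⇒≢ simple u′v′)))
  walkSeries-adjacent uv u′v′ (suc k) = cong +_ (adjacent (suc k) (s≤s z≤n) _ _ _ _ uv u′v′)

  weight-cong : ∀ {a b j a′ b′ j′} → walkSeries A j a ≗ walkSeries A j′ a′ →
    walkSeries A j b ≗ walkSeries A j′ b′ → weight A a b j ≗ weight A a′ b′ j′
  -- The constant term `δ j a` of a weight is the number of walks of length zero from `j` to `a`, so
  -- it is compared through the walk series towards `a`.
  weight-cong p q zero    = cong (ℤ._+ 0ℤ) (p 0)
  weight-cong p q (suc k) = cong (ℤ._+_ 0ℤ) (q k)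

  -- In each weight one of the two walk series is closed at an end of the edge and the other runs
  -- across it.
  deletionFactor-cong : ∀ {a b c d} → A a b ≡ true → A c d ≡ true →
                        deletionFactor A a b ≗ deletionFactor A c d
  deletionFactor-cong {a} {b} {c} {d} ab cd = S.+-cong
    (⊛-cong (weight-cong (walkSeries-closed a c) (walkSeries-adjacent ab cd))
            (weight-cong (walkSeries-closed b d) (walkSeries-adjacent ba dc)))
    (S.-‿cong (⊛-cong (weight-cong (walkSeries-adjacent ba dc) (walkSeries-closed b d))
                      (weight-cong (walkSeries-adjacent ab cd) (walkSeries-closed a c))))
    where
    ba : A b a ≡ true
    ba = trans (IsSimpleGraph.symmetric simple b a) ab
    dc : A d c ≡ true
    dc = trans (IsSimpleGraph.symmetric simple d c) cd

theorem3p2 : (n : ℕ) (X : AdjRel n) → IsSimpleGraph X → OneWalkRegular X →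
    (a b c d : Fin n) → X a b ≡ true → X c d ≡ true →
    Cospectral (deleteEdge X a b) (deleteEdge X c d)
-- Both characteristic polynomials are exhibited as reversals of one and the same series.
theorem3p2 n X simple regular a b c d ab cd = reversal-injective
  (reversal-cong determinants≗ (reversal-charPoly (deleteEdge X a b)))
  (reversal-charPoly (deleteEdge X c d))
  where
  open import Relation.Binary.Reasoning.Setoid S.setoid
  determinants≗ : S.determinant n (pencil (deleteEdge X a b)) ≗ S.determinant n (pencil (deleteEdge X c d))
  determinants≗ = begin
    S.determinant n (pencil (deleteEdge X a b))           ≈⟨ determinant-deleteEdge simple ab ⟩
    deletionFactor X a b ⊛ S.determinant n (pencil X)     ≈⟨ S.*-congʳ (deletionFactor-cong simple regular ab cd) ⟩
    deletionFactor X c d ⊛ S.determinant n (pencil X)     ≈⟨ determinant-deleteEdge simple cd ⟨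
    S.determinant n (pencil (deleteEdge X c d))           ∎
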